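{- If any of the following composite LTL modalities is added to the path formulas of $\mathsf{ATL}$, the semantics remains positional: $GF\psi_1\wedge FG\psi_2$; $G(\psi_1U\psi_2)$; $GF\psi_1\wedge FG\psi_2\wedge G\psi_3$; $G(\psi\vee X\psi)$. That is, for each of these modalities $\alpha$, the regular semantics of $\mathsf{ATL}+\{\alpha\}$ agrees with its positional semantics on all formulas and all models.
   Context: **Structures.** Fix a nonempty finite set $Ag$ of agents and a set $Prop$ of atomic propositions. A concurrent game structure (model) consists of a nonempty finite set of states $X$, nonempty action sets $Act_i(x)$ for each agent $i$ and state $x$, a transition function assigning a successor state to each state $x$ and each tuple $(a_i)_{i\in Ag}$ with $a_i\in Act_i(x)$, and a labelling $X\to2^{Prop}$. A strategy for a coalition $C\subseteq Ag$ assigns to each $i\in C$ and each nonempty finite sequence of states ending in $x$ an action in $Act_i(x)$; it is positional if these actions depend only on the last state $x$. **Logic.** For a set $\mathcal A$ of LTL formulas with free variables, $\mathsf{ATL}+\mathcal A$ has state formulas $\psi$ and path formulas $\varphi$: $$\psi::=p\mid\psi\vee\psi\mid\neg\psi\mid\langle C\rangle\varphi,\qquad \varphi::=X\psi\mid\psi U\psi\mid\psi R\psi\mid\alpha[\psi_1,\dots,\psi_n]$$ with $p\in Prop$, $C\subseteq Ag$, $\alpha(x_1,\dots,x_n)\in\mathcal A$ ($R$ is release; the $\psi_j$ are state formulas). In the regular semantics, $\langle C\rangle\varphi$ holds at $x$ iff there is a strategy for $C$ such that every infinite state sequence from $x$ consistent with it satisfies $\varphi$ (standard LTL semantics, state subformulas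 evaluated at states). In the positional semantics, the existential quantification is restricted to positional strategies for $C$ (the other agents remain unrestricted). -}

module Defs where

open import Data.Bool using (Bool; T)
open import Data.Empty using (⊥)
open import Data.Fin using (Fin)
open import Data.Fin.Subset using (Subset; _∈_)
open import Data.List using (List; applyUpTo)
open import Data.Nat using (ℕ; suc; _≤_; _<_; NonZero)
open import Data.Product using (Σ; ∃; _×_; proj₁; proj₂)
open import Data.Sum using (_⊎_)
open import Data.Unit using (⊤)
open import Function.Bundles using (_⇔_)
open import Level using (0ℓ)
open import Relation.Binary.PropositionalEquality using (_≡_)
open import Relation.Nullary using (¬_)
open import Relation.Unary using (Pred)

------------------------------------------------------------------------
-- Temporal operators on properties of time instants

Next : Pred ℕ 0ℓ → Pred ℕ 0ℓ
Next P k = P (suc k)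

Until : Pred ℕ 0ℓ → Pred ℕ 0ℓ → Pred ℕ 0ℓ
Until P Q k = ∃ λ n → k ≤ n × Q n × (∀ m → k ≤ m → m < n → P m)

-- Q holds up to and including the first instant where P holds, or forever
-- if there is none.
Release : Pred ℕ 0ℓ → Pred ℕ 0ℓ → Pred ℕ 0ℓ
Release P Q k = ∀ n → k ≤ n → Q n ⊎ (∃ λ m → k ≤ m × m < n × P m)

------------------------------------------------------------------------
-- LTL formulas with n free variables

infix  9 ¬′_ X_ F_ G_
infixr 8 _U_ _R_
infixr 7 _∧′_
infixr 6 _∨′_

data LTL (n : ℕ) : Set where
  var            : Fin n → LTL n
  true false     : LTL n
  ¬′_ X_         : LTL n → LTL n
  _∨′_ _∧′_      : LTL n → LTL n → LTL n
  _U_ _R_        : LTL n → LTL n → LTL n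

F_ G_ : ∀ {n} → LTL n → LTL n
F α = true U α
G α = false R α

⟦_⟧ : ∀ {n} → LTL n → (Fin n → Pred ℕ 0ℓ) → Pred ℕ 0ℓ
⟦ var i  ⟧ V   = V i
⟦ true   ⟧ V k = ⊤
⟦ false  ⟧ V k = ⊥
⟦ ¬′ α   ⟧ V k = ¬ ⟦ α ⟧ V k
⟦ X α    ⟧ V   = Next (⟦ α ⟧ V)
⟦ α ∨′ β ⟧ V k = ⟦ α ⟧ V k ⊎ ⟦ β ⟧ V k
⟦ α ∧′ β ⟧ V k = ⟦ α ⟧ V k × ⟦ β ⟧ V k
⟦ α U β  ⟧ V   = Until (⟦ α ⟧ V) (⟦ β ⟧ V)
⟦ α R β  ⟧ V   = Release (⟦ α ⟧ V) (⟦ β ⟧ V)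

-- An LTL formula together with its number of free variables.
Modality : Set
Modality = ∃ LTL

------------------------------------------------------------------------
-- Concurrent game structures, with agents Fin k

record CGS (k : ℕ) (AP : Set) : Set₁ where
  field
    size             : ℕ
    ⦃ size-nonZero ⦄ : NonZero size

  State : Set
  State = Fin size

  field
    Act       : Fin k → State → Set
    inhabited : ∀ i x → Act i x
    δ         : ∀ x → (∀ i → Act i x) → State
    label     : State → AP → Bool

module _ {k : ℕ} {AP : Set} (M : CGS k AP) where
  open CGS M

  -- A nonempty sequence of states ending in x is given as the list of the
  -- states before its last element, in chronological order, followed by x.
  Strategy : Subset k → Set
  Strategy C = ∀ i → i ∈ C → List State → (x : State) → Act i x

  Positional : ∀ {C} → Strategy C → Set
  Positional {C} σ =
    ∀ i (i∈C : i ∈ C) h h′ x → σ i i∈C h x ≡ σ i i∈C h′ x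

  Path : Set
  Path = ℕ → State

  -- The history at time n is π 0 , … , π (n − 1) followed by π n.
  Consistent : ∀ {C} → Strategy C → Path → Set
  Consistent {C} σ π =
    ∀ n → Σ (∀ i → Act i (π n)) λ a →
      (∀ i (i∈C : i ∈ C) → a i ≡ σ i i∈C (applyUpTo π n) (π n)) ×
      δ (π n) a ≡ π (suc n)

------------------------------------------------------------------------
-- ATL + 𝒜

module _ (k : ℕ) (AP : Set) (𝒜 : Pred Modality 0ℓ) where

  mutual
    data StateFormula : Set where
      atom  : AP → StateFormula
      _∨ˢ_  : StateFormula → StateFormula → StateFormula
      ¬ˢ_   : StateFormula → StateFormula
      ⟨_⟩_  : Subset k → PathFormula → StateFormula

    data PathFormula : Set where
      Xᵖ_       : StateFormula → PathFormula
      _Uᵖ_ _Rᵖ_ : StateFormula → StateFormula → PathFormula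
      _[_]      : (α : Σ Modality 𝒜) →
                  (Fin (proj₁ (proj₁ α)) → StateFormula) → PathFormula

data Semantics : Set where
  regular positional : Semantics

module _ {k : ℕ} {AP : Set} {𝒜 : Pred Modality 0ℓ} (M : CGS k AP) where
  open CGS M

  Admissible : Semantics → ∀ {C} → Strategy M C → Set
  Admissible regular    σ = ⊤
  Admissible positional σ = Positional M σ

  mutual
    _⊨[_]_ : State → Semantics → StateFormula k AP 𝒜 → Set
    x ⊨[ s ] atom p    = T (label x p)
    x ⊨[ s ] (ψ ∨ˢ χ)  = x ⊨[ s ] ψ ⊎ x ⊨[ s ] χ
    x ⊨[ s ] (¬ˢ ψ)    = ¬ (x ⊨[ s ] ψ)
    x ⊨[ s ] (⟨ C ⟩ φ) =
      Σ (Strategy M C) λ σ → Admissible s σ ×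
        (∀ π → π 0 ≡ x → Consistent M σ π → π ⊩[ s ] φ)

    _⊩[_]_ : Path M → Semantics → PathFormula k AP 𝒜 → Set
    π ⊩[ s ] (Xᵖ ψ)     = Next (λ n → π n ⊨[ s ] ψ) 0
    π ⊩[ s ] (ψ Uᵖ χ)   = Until (λ n → π n ⊨[ s ] ψ) (λ n → π n ⊨[ s ] χ) 0
    π ⊩[ s ] (ψ Rᵖ χ)   = Release (λ n → π n ⊨[ s ] ψ) (λ n → π n ⊨[ s ] χ) 0
    π ⊩[ s ] (α [ ψs ]) = ⟦ proj₂ (proj₁ α) ⟧ (λ i n → π n ⊨[ s ] ψs i) 0

SemanticsIsPositional : Pred Modality 0ℓ → Set₁
SemanticsIsPositional 𝒜 =
  ∀ (k : ℕ) ⦃ _ : NonZero k ⦄ (AP : Set) (M : CGS k AP)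
    (ψ : StateFormula k AP 𝒜) (x : CGS.State M) →
  _⊨[_]_ M x regular ψ ⇔ _⊨[_]_ M x positional ψ

{-# OPTIONS --safe #-}
module Submission where

-- For a fixed coalition, every objective except X ψ is an instance of
--   "E along the edges until Goal"  or  "E forever, GF P and FG Q".
-- Its winning region is a fixpoint μZ.νY.μV.Φ Z Y V. Ranking states by
-- the stages of the two least fixpoints and playing to the least rank is
-- positional and wins: the outer rank never increases, and once it is constant,
-- Q holds and the inner rank drops until P is met. Outside the region, the dual
-- fixpoint gives the environment a rank that can grow only at ¬ Q and drops at
-- Q ∧ P, so that it defeats every strategy, with or without memory.

open import Defs
open import Axiom.ExcludedMiddle using (ExcludedMiddle)
open import Data.Bool using (Bool; T)
open import Data.Empty using (⊥; ⊥-elim)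
open import Data.Fin using (Fin; zero; suc)
open import Data.Fin.Patterns using (0F; 1F; 2F)
open import Data.Fin.Subset using (Subset; _∈_)
open import Data.Fin.Subset.Properties using (_∈?_)
open import Data.List using (List; []; _∷_; _∷ʳ_; applyUpTo)
open import Data.List.Properties using (applyUpTo-∷ʳ)
open import Data.List.Relation.Unary.All using (All; []; _∷_)
open import Data.Maybe using (Maybe; just; nothing)
open import Data.Nat using (ℕ; zero; suc; _≤_; _<_; _⊔_; z≤n; s≤s; s≤s⁻¹)
open import Data.Nat.Properties
open import Data.Product using (Σ; ∃; _×_; _,_; proj₁; proj₂; map₂)
open import Data.Product.Function.NonDependent.Propositional using (_×-⇔_)
open import Data.Sum using (_⊎_; inj₁; inj₂)
import Data.Sum as Sum
open import Data.Sum.Function.Propositional using (_⊎-⇔_)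
open import Data.Unit using (⊤; tt)
open import Data.Vec.Properties.WithK using ([]=-irrelevant)
open import Function using (id; _∘_)
open import Function.Bundles using (_⇔_; mk⇔; Equivalence)
open import Level using (0ℓ)
open import Relation.Binary.PropositionalEquality using (_≡_; refl; sym; trans; cong; subst)
open import Relation.Binary.Definitions using (tri<; tri≈; tri>)
open import Relation.Nullary using (¬_; yes; no)
open import Relation.Nullary.Decidable using (⌊_⌋; toWitness; fromWitness)
open import Relation.Unary using (Pred; ｛_｝; _⊆_; ∅)
import Relation.Unary as Unary

-- Arenas and half-positional objectives

-- A game of the coalition against its environment: a move fixes the set of
-- possible successors, and the environment picks one of them.
record Arena : Set₁ where
  field
    size    : ℕ
    Move    : Fin size → Set
    Succ    : ∀ x → Move x → Pred (Fin size) 0ℓ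
    default : ∀ x → Move x
    total   : ∀ x (m : Move x) → ∃ (Succ x m)

  State : Set
  State = Fin size

  Outcome : (List State → ∀ x → Move x) → (ℕ → State) → Set
  Outcome σ π = ∀ n → Succ (π n) (σ (applyUpTo π n) (π n)) (π (suc n))

  -- The positional strategy may depend on the starting state, just as the strategy witnessing
  -- `⟨ C ⟩ φ` may.
  HalfPositional : Pred (ℕ → State) 0ℓ → Set
  HalfPositional O = ∀ x →
    (∃ λ σ → ∀ π → π 0 ≡ x → Outcome σ π → O π) →
    ∃ λ f → ∀ π → π 0 ≡ x → Outcome (λ _ → f) π → O π

  HalfPositional-resp : ∀ {O O′ : Pred (ℕ → State) 0ℓ} → O ⊆ O′ → O′ ⊆ O →
                        HalfPositional O → HalfPositional O′
  HalfPositional-resp to from hp x (σ , win) =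
    map₂ (λ w π e c → to (w π e c)) (hp x (σ , λ π e c → from (win π e c)))

-- Induction, minima and bounds

induction-from : ∀ {A : Pred ℕ 0ℓ} {m} → A m → (∀ {n} → m ≤ n → A n → A (suc n)) →
                 ∀ {n} → m ≤ n → A n
induction-from {A} {m} base step m≤n = go (≤⇒≤′ m≤n)
  where
  open import Data.Nat using (_≤′_; ≤′-refl; ≤′-step)
  go : ∀ {n} → m ≤′ n → A n
  go ≤′-refl       = base
  go (≤′-step m≤n) = step (≤′⇒≤ m≤n) (go m≤n)

module _ (em : ExcludedMiddle 0ℓ) where

  least : ∀ {A : Pred ℕ 0ℓ} n → A n → ∃ λ k → A k × (∀ i → A i → k ≤ i)
  least {A} n a with em {A 0}
  ... | yes a₀ = 0 , a₀ , λ _ _ → z≤n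
  least zero    a | no ¬a₀ = ⊥-elim (¬a₀ a)
  least {A} (suc n) a | no ¬a₀ with least {A ∘ suc} n a
  ... | k , ak , min = suc k , ak , λ where
    zero    a₀ → ⊥-elim (¬a₀ a₀)
    (suc i) ai → s≤s (min i ai)

  -- The maximum of finitely many witnesses serves for all of them. This is what lets stages indexed
  -- by `ℕ` replace ordinals in the fixpoints.
  uniform-bound : ∀ {n} {A : Pred (Fin n) 0ℓ} {B : ℕ → Pred (Fin n) 0ℓ} →
                  (∀ {i j} → i ≤ j → B i ⊆ B j) →
                  (∀ x → A x → ∃ λ k → B k x) → ∃ λ k → ∀ x → A x → B k x
  uniform-bound {zero}  mono h = 0 , λ ()
  uniform-bound {suc n} {A} {B} mono h
    with uniform-bound {n} {A ∘ suc} {λ k → B k ∘ suc} (λ i≤j → mono i≤j) (λ x → h (suc x))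
       | em {A zero}
  ... | k , b | no ¬a = k , λ where
    zero    a → ⊥-elim (¬a a)
    (suc x) a → b x a
  ... | k , b | yes a₀ = proj₁ (h zero a₀) ⊔ k , λ where
    zero    _ → mono (m≤m⊔n _ k) (proj₂ (h zero a₀))
    (suc x) a → mono (m≤n⊔m _ k) (b x a)

  -- Plays against a given strategy

  module _ (𝒢 : Arena) where
    open Arena 𝒢

    -- `A` is data carried along the play, on which the environment's choice in `step` may depend.
    module Playout {A : List State → Pred State 0ℓ} (σ : List State → ∀ x → Move x)
      (step : ∀ h x → A h x → Σ State λ y → Succ x (σ h x) y × A (h ∷ʳ x) y)
      {x₀} (a₀ : A [] x₀) where

      config : ℕ → Σ (List State) λ h → Σ State (A h)
      config zero    = [] , x₀ , a₀
      config (suc n) with config n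
      ... | h , x , a with step h x a
      ... | y , _ , b = h ∷ʳ x , y , b

      history : ℕ → List State
      history = proj₁ ∘ config

      path : ℕ → State
      path n = proj₁ (proj₂ (config n))

      status : ∀ n → A (history n) (path n)
      status n = proj₂ (proj₂ (config n))

      history-path : ∀ n → history n ≡ applyUpTo path n
      history-path zero    = refl
      history-path (suc n) =
        trans (cong (_∷ʳ path n) (history-path n)) (applyUpTo-∷ʳ path n)

      outcome : Outcome σ path
      outcome n = subst (λ h → Succ (path n) (σ h (path n)) (path (suc n)))
                        (history-path n)
                        (proj₁ (proj₂ (step (history n) (path n) (status n))))

    -- Only the first move counts, so `σ []` serves at every state. The first edge of a play of it
    -- extends to a play of `σ`, which `win` judges at the same second state.
    next-halfPositional : ∀ (P : Pred State 0ℓ) → HalfPositional (λ π → P (π 1))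
    next-halfPositional P x₀ (σ , win) = σ [] , λ π e c →
      let step : ∀ h x → (h ≡ [] → x ≡ π 0) →
                 Σ State λ y → Succ x (σ h x) y × (h ∷ʳ x ≡ [] → y ≡ π 0)
          step = λ where
            []      x x≡ → π 1 , subst (λ z → Succ z (σ [] z) (π 1)) (sym (x≡ refl)) (c 0) , λ ()
            (z ∷ h) x _  → let (y , s) = total x _ in y , s , λ ()
          open Playout {A = λ h x → h ≡ [] → x ≡ π 0} σ step (λ _ → refl)
      in win path e outcome

    -- The winning fixpoint and its dual

    module Objective (Goal : Pred State 0ℓ) (E : State → Pred State 0ℓ)
                     (P Q : Pred State 0ℓ) where

      Reaches Rabin Objective : Pred (ℕ → State) 0ℓ
      Reaches π = ∃ λ n → Goal (π n) × (∀ m → m < n → E (π m) (π (suc m)))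
      Rabin π = (∀ n → E (π n) (π (suc n))) ×
                (∀ n → ∃ λ m → n ≤ m × P (π m)) ×
                (∃ λ n → ∀ m → n ≤ m → Q (π m))
      Objective π = Reaches π ⊎ Rabin π

      -- `E` is tested on each edge taken: a choice of the environment that breaks `E` escapes at
      -- once, whatever its target.
      Cpre Escape : Pred State 0ℓ → Pred State 0ℓ
      Cpre   S x = Σ (Move x) λ m → ∀ y → Succ x m y → E x y × S y
      Escape S x = ∀ m → ∃ λ y → Succ x m y × (E x y → S y)

      Cpre-mono : ∀ {S S′} → S ⊆ S′ → Cpre S ⊆ Cpre S′
      Cpre-mono S⊆S′ = map₂ λ c y s → map₂ S⊆S′ (c y s)

      Escape-mono : ∀ {S S′} → S ⊆ S′ → Escape S ⊆ Escape S′
      Escape-mono S⊆S′ e m = let (y , s , g) = e m in y , s , S⊆S′ ∘ g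

      ¬Cpre⇒Escape : ∀ {S S′ x} → (∀ {y} → ¬ S y → S′ y) → ¬ Cpre S x → Escape S′ x
      ¬Cpre⇒Escape {S} {S′} {x} ¬S⊆S′ ¬c m with em {∃ λ y → Succ x m y × (E x y → S′ y)}
      ... | yes e = e
      ... | no ¬e = ⊥-elim (¬c (m , λ y s → r y s , in-S y s))
        where
        r : ∀ y → Succ x m y → E x y
        r y s with em {E x y}
        ... | yes xEy = xEy
        ... | no ¬xEy = ⊥-elim (¬e (y , s , ⊥-elim ∘ ¬xEy))
        in-S : ∀ y → Succ x m y → S y
        in-S y s with em {S y}
        ... | yes Sy = Sy
        ... | no ¬Sy = ⊥-elim (¬e (y , s , λ _ → ¬S⊆S′ ¬Sy))

      -- Away from the goal there are three ways to go on: lower the outer rank (`Z`), which does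
      -- not ask for `Q`; meet `P` and start the inner rank afresh (`Y`); or lower the inner rank
      -- (`V`).
      Φ : (Z Y V : Pred State 0ℓ) → Pred State 0ℓ
      Φ Z Y V x = Goal x ⊎ Cpre Z x ⊎ (Q x × P x × Cpre Y x) ⊎ (Q x × Cpre V x)

      Φ-mono : ∀ {Z Z′ Y Y′ V V′} → Z ⊆ Z′ → Y ⊆ Y′ → V ⊆ V′ → Φ Z Y V ⊆ Φ Z′ Y′ V′
      Φ-mono z y x = Sum.map₂ (Sum.map (Cpre-mono z)
        (Sum.map (map₂ (map₂ (Cpre-mono y))) (map₂ (Cpre-mono x))))

      -- The finite stages of `μV.Φ Z Y V`, with stage 0 empty.
      data Attr (Z Y : Pred State 0ℓ) : ℕ → Pred State 0ℓ where
        attr : ∀ {j x} → Φ Z Y (Attr Z Y j) x → Attr Z Y (suc j) x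

      Attr-mono : ∀ {Z Z′ Y Y′ i j} → Z ⊆ Z′ → Y ⊆ Y′ → i ≤ j → Attr Z Y i ⊆ Attr Z′ Y′ j
      Attr-mono z y (s≤s i≤j) (attr φ) = attr (Φ-mono z y (Attr-mono z y i≤j) φ)

      -- The stages of μZ.νY.μV.Φ Z Y V. The greatest fixpoint is the union of
      -- the post-fixpoints, which are Boolean to keep the predicate in Set.
      data Win : ℕ → Pred State 0ℓ where
        stage : ∀ {k x} (Y : State → Bool) → T (Y x) →
              (∀ y → T (Y y) → ∃ λ j → Attr (Win k) (T ∘ Y) j y) → Win (suc k) x

      Win-mono : ∀ {i j} → i ≤ j → Win i ⊆ Win j
      Win-mono (s≤s i≤j) (stage Y Yx post) =
        stage Y Yx λ y Yy → map₂ (Attr-mono (Win-mono i≤j) id ≤-refl) (post y Yy)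

      Win-unfold : ∀ {k x} → Win (suc k) x → ∃ λ j → Attr (Win k) (Win (suc k)) j x
      Win-unfold (stage Y Yx post) =
        map₂ (Attr-mono id (λ Yy → stage Y Yy post) ≤-refl) (post _ Yx)

      Win-coinduction : ∀ {k} (Y : Pred State 0ℓ) →
                        (∀ y → Y y → ∃ λ j → Attr (Win k) Y j y) → Y ⊆ Win (suc k)
      Win-coinduction Y post Yx =
        stage (λ y → ⌊ em {Y y} ⌋) (fromWitness Yx)
        λ y Yy → map₂ (Attr-mono id fromWitness ≤-refl) (post y (toWitness Yy))

      -- The attractors of `Win (suc k)` contain it by `Win-unfold`, so by monotonicity their union
      -- is again a post-fixpoint.
      Attr⇒Win : ∀ {k j} → Attr (Win k) (Win (suc k)) j ⊆ Win (suc k)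
      Attr⇒Win {k} {j} a = Win-coinduction
        (λ y → ∃ λ j → Attr (Win k) (Win (suc k)) j y)
        (λ y (j , a) → j , Attr-mono id Win-unfold ≤-refl a)
        (j , a)

      -- The stages of the dual of νY.μV.Φ Z Y V, for Z the union of the Win i.
      Lost : ℕ → Pred State 0ℓ
      Lost zero    x = ⊥
      Lost (suc k) x = Σ (State → Bool) λ S → T (S x) × (∀ z → T (S z) →
        ¬ Goal z ×
        Escape (λ y → ¬ ∃ λ i → Win i y) z ×
        (Q z → P z → Escape (Lost k) z) ×
        (Q z → Escape (T ∘ S) z))

      Lost-mono : ∀ {i j} → i ≤ j → Lost i ⊆ Lost j
      Lost-mono (s≤s i≤j) (S , Sx , post) = S , Sx , λ z Sz →
        let (g , e , d , c) = post z Sz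
        in g , e , (λ q p → Escape-mono (Lost-mono i≤j) (d q p)) , c

      -- On finitely many states both hierarchies stop growing, at `K` and `L`. A state outside the
      -- attractor of the set `Y` of states not lost lies in `S`, which satisfies the clauses of
      -- `Lost (suc L)`. Hence `Y` is a post-fixpoint over `Win K` and is contained in
      -- `Win (suc K)`.
      ¬Win⇒Lost : ∀ {x} → ¬ (∃ λ k → Win k x) → ∃ λ k → Lost k x
      ¬Win⇒Lost {x} ¬w with em {∃ λ k → Lost k x}
      ... | yes l = l
      ... | no ¬l = ⊥-elim (¬w (suc K , Win-coinduction Y post ¬l))
        where
        K L : ℕ
        K = proj₁ (uniform-bound Win-mono (λ x (w : ∃ λ k → Win k x) → w))
        L = proj₁ (uniform-bound Lost-mono (λ x (l : ∃ λ k → Lost k x) → l))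

        Win⊆ : ∀ {x} → ∃ (λ k → Win k x) → Win K x
        Win⊆ = proj₂ (uniform-bound Win-mono (λ x (w : ∃ λ k → Win k x) → w)) _

        Lost⊆ : ∀ {x} → ∃ (λ k → Lost k x) → Lost L x
        Lost⊆ = proj₂ (uniform-bound Lost-mono (λ x (l : ∃ λ k → Lost k x) → l)) _

        Y S : Pred State 0ℓ
        Y y = ¬ ∃ λ k → Lost k y
        S y = ¬ ∃ λ j → Attr (Win K) Y j y

        Lost-of-¬Y : ∀ {y} → ¬ Y y → Lost L y
        Lost-of-¬Y {y} ¬Yy with em {∃ λ k → Lost k y}
        ... | yes l = Lost⊆ l
        ... | no Yy = ⊥-elim (¬Yy Yy)

        ¬Cpre-Attr : ∀ {z} → Q z → S z → ¬ Cpre (λ y → ∃ λ j → Attr (Win K) Y j y) z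
        ¬Cpre-Attr q Sz (m , c) =
          -- The successors may lie in different stages; `J` is one stage for all of them.
          let (J , b) = uniform-bound (Attr-mono id id) (λ y s → proj₂ (c y s))
          in Sz (suc J , attr (inj₂ (inj₂ (inj₂ (q , m , λ y s → proj₁ (c y s) , b y s)))))

        S⇒Lost : ∀ {y} → S y → Lost (suc L) y
        S⇒Lost Sy = (λ z → ⌊ em {S z} ⌋) , fromWitness Sy , λ z Tz →
          let Sz = toWitness Tz in
          (λ g → Sz (1 , attr (inj₁ g))) ,
          ¬Cpre⇒Escape (λ ¬w → ¬w ∘ Win⊆) (λ c → Sz (1 , attr (inj₂ (inj₁ c)))) ,
          (λ q p → ¬Cpre⇒Escape Lost-of-¬Y (λ c → Sz (1 , attr (inj₂ (inj₂ (inj₁ (q , p , c))))))) ,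
          (λ q → ¬Cpre⇒Escape fromWitness (¬Cpre-Attr q Sz))

        post : ∀ y → Y y → ∃ λ j → Attr (Win K) Y j y
        post y Yy with em {∃ λ j → Attr (Win K) Y j y}
        ... | yes a = a
        ... | no Sy = ⊥-elim (Yy (suc L , S⇒Lost Sy))

      -- Counterplay from the lost states

      Descends : State → ℕ → ℕ → Set
      Descends x k k′ = Q x → k′ ≤ k × (P x → k′ < k)

      -- Unless `E` breaks: outside `Q` the play stays out of the winning region and any new rank
      -- will do; at `Q` and `P` the rank drops; at `Q` without `P` the play stays in `S`, and
      -- `post`, which covers all of `S`, keeps the rank.
      answer : ∀ {k x} → Lost k x → (m : Move x) →
               Σ State λ y → Succ x m y × (E x y → ∃ λ k′ → Lost k′ y × Descends x k k′)
      answer {suc k} {x} (S , Sx , post) m with post x Sx | em {Q x} | em {P x}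
      ... | _ , esc , _ | no ¬q | _ =
        let (y , s , g) = esc m
        in y , s , λ r → let (k′ , l) = ¬Win⇒Lost (g r) in k′ , l , ⊥-elim ∘ ¬q
      ... | _ , _ , drop , _ | yes q | yes p =
        let (y , s , g) = drop q p m
        in y , s , λ r → k , g r , λ _ → n≤1+n k , λ _ → ≤-refl
      ... | _ , _ , _ , stay | yes q | no ¬p =
        let (y , s , g) = stay q m
        in y , s , λ r → suc k , (S , g r , post) , λ _ → ≤-refl , ⊥-elim ∘ ¬p

      -- Playing the answers against `σ` avoids the goal as long as `E` holds, and `GF P` with
      -- `FG Q` would make the rank descend forever.
      Lost⇒¬winning : ∀ {k x} → Lost k x → (σ : List State → ∀ x → Move x) →
                      ¬ (∀ π → π 0 ≡ x → Outcome σ π → Objective π)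
      Lost⇒¬winning {k₀} {x₀} l₀ σ win = refute (win path refl outcome)
        where
        -- nothing: E has been violated
        Status : List State → Pred State 0ℓ
        Status _ x = Maybe (∃ λ k → Lost k x)

        Alive : ∀ {x} → ℕ → Maybe (∃ λ k → Lost k x) → Set
        Alive {x} k s = Σ (Lost k x) λ l → s ≡ just (k , l)

        step : ∀ h x → Status h x →
               Σ State λ y → Succ x (σ h x) y × Status (h ∷ʳ x) y
        step h x nothing = let (y , s) = total x (σ h x) in y , s , nothing
        step h x (just (k , l)) with answer l (σ h x)
        ... | y , s , g with em {E x y}
        ... | yes r = y , s , just (let (k′ , l′ , _) = g r in k′ , l′)
        ... | no _  = y , s , nothing

        step-alive : ∀ h x (s : Status h x) {k} → Alive k s → E x (proj₁ (step h x s)) →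
                     ∃ λ k′ → Alive k′ (proj₂ (proj₂ (step h x s))) × Descends x k k′
        step-alive h x _ (l , refl) r with answer l (σ h x)
        ... | y , s , g with em {E x y}
        ... | yes r′ = let (k′ , l′ , d) = g r′ in k′ , (l′ , refl) , d
        ... | no ¬r  = ⊥-elim (¬r r)

        open Playout {A = Status} σ step (just (k₀ , l₀))

        alive-suc : ∀ n {k} → Alive k (status n) → E (path n) (path (suc n)) →
                    ∃ λ k′ → Alive k′ (status (suc n)) × Descends (path n) k k′
        alive-suc n = step-alive (history n) (path n) (status n)

        alive : ∀ n → (∀ m → m < n → E (path m) (path (suc m))) →
                ∃ λ k → Alive k (status n)
        alive zero    _ = k₀ , l₀ , refl
        alive (suc n) r =
          let (_ , a)      = alive n λ m m<n → r m (m<n⇒m<1+n m<n)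
              (k′ , a′ , _) = alive-suc n a (r n ≤-refl)
          in k′ , a′

        ¬Goal : ∀ k {x} → Lost k x → ¬ Goal x
        ¬Goal (suc k) (_ , Sx , post) = proj₁ (post _ Sx)

        refute : ¬ Objective path
        refute (inj₁ (n , g , r)) = let (k , l , _) = alive n r in ¬Goal k l g
        refute (inj₂ (r , gfp , N , fgq)) =
          let (k , a) = alive N (λ m _ → r m) in descend (suc k) N ≤-refl (k , ≤-refl , a)
          where
          descend : ∀ b n → N ≤ n → ¬ (∃ λ k → k < b × Alive k (status n))
          -- `b` strictly bounds the rank at `n`. Since `Q` holds from `N` on, the rank does not
          -- rise before the next visit to `P`, where it drops.
          descend (suc b) n N≤n (k , k<b , a) =
            let (m , n≤m , p)   = gfp n
                (k′ , k′≤k , a′) = induction-from {A = λ i → ∃ λ k′ → k′ ≤ k × Alive k′ (status i)}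
                  (k , ≤-refl , a)
                  (λ {i} n≤i (k′ , k′≤k , a′) →
                    let (k″ , a″ , d) = alive-suc i a′ (r i)
                    in k″ , ≤-trans (proj₁ (d (fgq i (≤-trans N≤n n≤i)))) k′≤k , a″)
                  n≤m
                N≤m             = ≤-trans N≤n n≤m
                (k″ , a″ , d)    = alive-suc m a′ (r m)
            in descend b (suc m) (m≤n⇒m≤1+n N≤m)
                 (k″ , ≤-trans (proj₂ (d (fgq m N≤m)) p) (≤-trans k′≤k (s≤s⁻¹ k<b)) , a″)

      -- The positional strategy on the winning region

      -- The minimality clauses determine `k` and `j` from the state alone, so a move chosen without
      -- the history fits the stages known along a play.
      Ranked : Pred State 0ℓ
      Ranked x = ∃ λ k → ∃ λ j →
        (∀ i → Win i x → suc k ≤ i) × Win (suc k) x ×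
        (∀ i → Attr (Win k) (Win (suc k)) i x → suc j ≤ i) ×
        Φ (Win k) (Win (suc k)) (Attr (Win k) (Win (suc k)) j) x

      rank : ∀ {k x} → Win k x → Ranked x
      rank {k} {x} w with least {λ i → Win i x} k w
      -- Stage 0 is empty, so a least stage is a successor; the same holds for `Attr` below.
      ... | suc k , w , kmin with Win-unfold w
      ... | j , a with least {λ i → Attr (Win k) (Win (suc k)) i x} j a
      ... | suc j , attr φ , jmin = k , j , kmin , w , jmin , φ

      move : ∀ {Z Y V x} → Φ Z Y V x → Move x
      move {x = x} (inj₁ _)                    = default x
      move (inj₂ (inj₁ (m , _)))               = m
      move (inj₂ (inj₂ (inj₁ (_ , _ , m , _)))) = m
      move (inj₂ (inj₂ (inj₂ (_ , m , _))))     = m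

      Progress : (Z Y V : Pred State 0ℓ) (x y : State) → Set
      Progress Z Y V x y =
        Goal x ⊎ E x y × (Z y ⊎ (Q x × P x × Y y) ⊎ (Q x × V y))

      move-progress : ∀ {Z Y V x} (φ : Φ Z Y V x) {y} → Succ x (move φ) y → Progress Z Y V x y
      move-progress (inj₁ g) s = inj₁ g
      move-progress (inj₂ (inj₁ (_ , c))) s = inj₂ (map₂ inj₁ (c _ s))
      move-progress (inj₂ (inj₂ (inj₁ (q , p , _ , c)))) s =
        inj₂ (map₂ (λ y → inj₂ (inj₁ (q , p , y))) (c _ s))
      move-progress (inj₂ (inj₂ (inj₂ (q , _ , c)))) s =
        inj₂ (map₂ (λ y → inj₂ (inj₂ (q , y))) (c _ s))

      strategy : ∀ x → Move x
      strategy x with em {Ranked x}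
      ... | yes (_ , _ , _ , _ , _ , φ) = move φ
      ... | no _                        = default x

      -- Minimality forces the outer stage used by `strategy` to be `k` and its inner stage to be at
      -- most `j`, so its progress carries over by `Attr-mono`.
      strategy-progress : ∀ {k j x y} → Win (suc k) x → ¬ Win k x →
        Attr (Win k) (Win (suc k)) (suc j) x → Succ x (strategy x) y →
        Progress (Win k) (Win (suc k)) (Attr (Win k) (Win (suc k)) j) x y
      strategy-progress {k} {j} {x} w ¬w a s with em {Ranked x}
      ... | no ¬r = ⊥-elim (¬r (rank w))
      ... | yes (k′ , j′ , kmin , w′ , jmin , φ)
        with ≤-antisym (s≤s⁻¹ (kmin (suc k) w)) (≮⇒≥ λ k′<k → ¬w (Win-mono k′<k w′))
      ... | refl = Sum.map₂ (map₂ (Sum.map₂ (Sum.map₂ (map₂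
                     (Attr-mono id id (s≤s⁻¹ (jmin (suc j) a)))))))
                   (move-progress φ s)

      strategy-safe : ∀ {k x y} → Win k x → Succ x (strategy x) y →
                      Goal x ⊎ E x y × (∃ λ k → Win k y)
      strategy-safe w s with rank w
      ... | k , j , kmin , w , jmin , φ =
        Sum.map₂ (map₂ Sum.[ (k ,_) , Sum.[ (λ (_ , _ , w) → suc k , w) ,
                                        (λ (_ , a) → suc k , Attr⇒Win a) ] ])
          (strategy-progress w (λ w → 1+n≰n (kmin k w)) (attr φ) s)

      module _ {π : ℕ → State} (out : Outcome (λ _ → strategy) π) where

        invariant : ∀ {k} → Win k (π 0) → ∀ n → (∀ m → m < n → ¬ Goal (π m)) →
                    ∃ λ k → Win k (π n)
        invariant w zero    _  = _ , w
        invariant w (suc n) ¬g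
          with strategy-safe (proj₂ (invariant w n λ m m<n → ¬g m (m<n⇒m<1+n m<n))) (out n)
        ... | inj₁ g       = ⊥-elim (¬g n ≤-refl g)
        ... | inj₂ (_ , w) = w

        safe : ∀ {k} → Win k (π 0) → ∀ n → (∀ m → m ≤ n → ¬ Goal (π m)) → E (π n) (π (suc n))
        safe w n ¬g
          with strategy-safe (proj₂ (invariant w n λ m m<n → ¬g m (<⇒≤ m<n))) (out n)
        ... | inj₁ g       = ⊥-elim (¬g n ≤-refl g)
        ... | inj₂ (r , _) = r

        module _ (¬goal : ∀ n → ¬ Goal (π n)) where

          Settled : ℕ → ℕ → Set
          Settled k n = Win (suc k) (π n) × ¬ Win k (π n)

          -- The goal and a drop of the outer rank being excluded, both remaining branches of
          -- `Progress` carry `Q`.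
          settled-progress : ∀ {k n j} → Settled k n → ¬ Win k (π (suc n)) →
            Attr (Win k) (Win (suc k)) (suc j) (π n) →
            Q (π n) × Win (suc k) (π (suc n)) ×
            (P (π n) ⊎ Attr (Win k) (Win (suc k)) j (π (suc n)))
          settled-progress {n = n} {j} (w , ¬w) ¬w′ a with strategy-progress w ¬w a (out n)
          ... | inj₁ g                                = ⊥-elim (¬goal n g)
          ... | inj₂ (_ , inj₁ w′)                    = ⊥-elim (¬w′ w′)
          ... | inj₂ (_ , inj₂ (inj₁ (q , p , w′)))   = q , w′ , inj₁ p
          ... | inj₂ (_ , inj₂ (inj₂ (q , a′)))       = q , Attr⇒Win a′ , inj₂ a′

          settled-step : ∀ {k n} → Settled k n → ¬ Win k (π (suc n)) →
                         Q (π n) × Win (suc k) (π (suc n))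
          settled-step s ¬w′ with Win-unfold (proj₁ s)
          ... | suc j , a = let (q , w′ , _) = settled-progress {j = j} s ¬w′ a in q , w′

          -- Induction on the outer stage: either `Win k` is entered at some time from `n` on, and
          -- the argument restarts there, or the rank is constant from `n` on.
          settle : ∀ k n → Win k (π n) → ∃ λ k → ∃ λ N → ∀ i → N ≤ i → Settled k i
          settle (suc k) n w with em {∃ λ i → n ≤ i × Win k (π i)}
          ... | yes (i , _ , w′) = settle k i w′
          ... | no ¬w = k , n , λ i n≤i → induction-from {A = Settled k}
            (w , λ w′ → ¬w (n , ≤-refl , w′))
            (λ {i} n≤i s → let ¬w′ = λ w′ → ¬w (suc i , m≤n⇒m≤1+n n≤i , w′)
                           in proj₂ (settled-step s ¬w′) , ¬w′)
            n≤i

          -- Each step from a state outside `P` lowers `j`, and stage 0 is empty.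
          recurrence : ∀ {k N} → (∀ i → N ≤ i → Settled k i) → ∀ j n → N ≤ n →
                       Attr (Win k) (Win (suc k)) j (π n) → ∃ λ m → n ≤ m × P (π m)
          recurrence st (suc j) n N≤n a
            with settled-progress {j = j} (st n N≤n) (proj₂ (st (suc n) (m≤n⇒m≤1+n N≤n))) a
          ... | _ , _ , inj₁ p = n , ≤-refl , p
          ... | _ , _ , inj₂ a′ =
            let (m , n<m , p) = recurrence st j (suc n) (m≤n⇒m≤1+n N≤n) a′
            in m , <⇒≤ n<m , p

          rabin : ∀ {k} → Win k (π 0) → Rabin π
          rabin {k} w with settle k 0 w
          ... | k , N , st =
            (λ n → safe w n λ m _ → ¬goal m) ,
            (λ n → let i       = n ⊔ N
                       N≤i     = m≤n⊔m n N
                       (j , a) = Win-unfold (proj₁ (st i N≤i))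
                       (m , i≤m , p) = recurrence st j i N≤i a
                   in m , ≤-trans (m≤m⊔n n N) i≤m , p) ,
            (N , λ i N≤i → proj₁ (settled-step (st i N≤i) (proj₂ (st (suc i) (m≤n⇒m≤1+n N≤i)))))

        strategy-wins : ∀ {k} → Win k (π 0) → Objective π
        strategy-wins w with em {∃ λ n → Goal (π n)}
        ... | no ¬g = inj₂ (rabin (λ n g → ¬g (n , g)) w)
        ... | yes (n , g) with least {Goal ∘ π} n g
        -- No goal occurs before the first one, as `safe` requires.
        ... | n , g , min = inj₁ (n , g , λ m m<n →
          safe w m λ i i≤m g′ → <⇒≱ m<n (≤-trans (min i g′) i≤m))

      -- A winning strategy, even with memory, excludes `Lost`; so the start lies in the winning
      -- region.
      objective-halfPositional : HalfPositional Objective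
      objective-halfPositional x (σ , win) with em {∃ λ k → Win k x}
      ... | no ¬w = ⊥-elim (Lost⇒¬winning (proj₂ (¬Win⇒Lost ¬w)) σ win)
      ... | yes (k , w) = strategy , λ { π refl out → strategy-wins out w }

    -- Until, release and Rabin conditions as instances

    open Objective using (objective-halfPositional)

    -- With `P` of the objective empty, its Rabin part is unsatisfiable and the goal must be
    -- reached.
    until-halfPositional : ∀ P Q → HalfPositional (λ π → Until (P ∘ π) (Q ∘ π) 0)
    until-halfPositional P Q = HalfPositional-resp
      (λ where (inj₁ (n , q , p))               → n , z≤n , q , λ m _ → p m
               (inj₂ (_ , recur , _)) → ⊥-elim (proj₂ (proj₂ (recur 0))))
      (λ (n , _ , q , p) → inj₁ (n , q , λ m → p m z≤n))
      (objective-halfPositional Q (λ x _ → P x) ∅ Unary.U)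

    -- The goal is the moment of release, where both properties hold. Without it `Q` must hold
    -- forever, and `GF` and `FG` are made trivial.
    release-halfPositional : ∀ P Q → HalfPositional (λ π → Release (P ∘ π) (Q ∘ π) 0)
    release-halfPositional P Q = HalfPositional-resp to from
      (objective-halfPositional (λ x → P x × Q x) (λ x _ → Q x) Unary.U Unary.U)
      where
      open Objective (λ x → P x × Q x) (λ x _ → Q x) Unary.U Unary.U using (Objective)

      to : Objective ⊆ λ π → Release (P ∘ π) (Q ∘ π) 0
      to (inj₂ (q , _))           n _ = inj₁ (q n)
      to (inj₁ (m , (p , q) , r)) n _ with <-cmp n m
      ... | tri< n<m _ _  = inj₁ (r n n<m)
      ... | tri≈ _ refl _ = inj₁ q
      ... | tri> _ _ m<n  = inj₂ (m , z≤n , m<n , p)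

      from : (λ π → Release (P ∘ π) (Q ∘ π) 0) ⊆ Objective
      from {π} rel with em {∃ λ n → P (π n)}
      ... | no ¬p = inj₂
        ( (λ n → Sum.[ id , (λ (m , _ , _ , p) → ⊥-elim (¬p (m , p))) ] (rel n z≤n))
        , (λ n → n , ≤-refl , tt) , 0 , λ _ _ → tt )
      ... | yes (n , p) with least {P ∘ π} n p
      ... | n , p , min = inj₁ (n , (p , q n ≤-refl) , λ m → q m ∘ <⇒≤)
        where
        q : ∀ m → m ≤ n → Q (π m)
        q m m≤n = Sum.[ id , (λ (i , _ , i<m , p) →
          ⊥-elim (<⇒≱ i<m (≤-trans m≤n (min i p)))) ] (rel m z≤n)

    rabin-halfPositional : ∀ E P Q → HalfPositional (Objective.Rabin ∅ E P Q)
    rabin-halfPositional E P Q = HalfPositional-resp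
      (λ where (inj₁ ())
               (inj₂ o) → o)
      inj₂ (objective-halfPositional ∅ E P Q)

-- Temporal operators: characterisations and congruence

globally : ∀ {P} → Release (λ _ → ⊥) P 0 ⇔ (∀ k → P k)
globally = mk⇔ (λ g k → Sum.[ id , (λ ()) ] (g k z≤n)) (λ g k _ → inj₁ (g k))

infinitely-often : ∀ {P} → Release (λ _ → ⊥) (Until (λ _ → ⊤) P) 0 ⇔
                   (∀ k → ∃ λ m → k ≤ m × P m)
infinitely-often = mk⇔
  (λ g k → map₂ (map₂ proj₁) (Equivalence.to globally g k))
  (λ g k _ → let (m , k≤m , p) = g k in inj₁ (m , k≤m , p , _))

eventually-always : ∀ {P} → Until (λ _ → ⊤) (Release (λ _ → ⊥) P) 0 ⇔
                    (∃ λ k → ∀ m → k ≤ m → P m)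
eventually-always = mk⇔
  (λ (k , _ , g , _) → k , λ m k≤m → Sum.[ id , (λ ()) ] (g m k≤m))
  (λ (k , g) → k , z≤n , (λ m k≤m → inj₁ (g m k≤m)) , _)

Until-map : ∀ {P P′ Q Q′ : Pred ℕ 0ℓ} → P ⊆ P′ → Q ⊆ Q′ → Until P Q ⊆ Until P′ Q′
Until-map f g (n , k≤n , q , p) = n , k≤n , g q , λ m k≤m m<n → f (p m k≤m m<n)

Release-map : ∀ {P P′ Q Q′ : Pred ℕ 0ℓ} → P ⊆ P′ → Q ⊆ Q′ → Release P Q ⊆ Release P′ Q′
Release-map f g r n k≤n =
  Sum.map g (λ (m , k≤m , m<n , p) → m , k≤m , m<n , f p) (r n k≤n)

⟦⟧-cong : ∀ {n} (α : LTL n) {V V′ : Fin n → Pred ℕ 0ℓ} →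
          (∀ i k → V i k ⇔ V′ i k) → ∀ k → ⟦ α ⟧ V k ⇔ ⟦ α ⟧ V′ k
⟦⟧-cong (var i)  e k = e i k
⟦⟧-cong true     e k = mk⇔ id id
⟦⟧-cong false    e k = mk⇔ id id
⟦⟧-cong (¬′ α)   e k = let open Equivalence (⟦⟧-cong α e k) in mk⇔ (_∘ from) (_∘ to)
⟦⟧-cong (X α)    e k = ⟦⟧-cong α e (suc k)
⟦⟧-cong (α ∨′ β) e k = ⟦⟧-cong α e k ⊎-⇔ ⟦⟧-cong β e k
⟦⟧-cong (α ∧′ β) e k = ⟦⟧-cong α e k ×-⇔ ⟦⟧-cong β e k
⟦⟧-cong (α U β)  e k =
  mk⇔ (Until-map (to (⟦⟧-cong α e _)) (to (⟦⟧-cong β e _)))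
      (Until-map (from (⟦⟧-cong α e _)) (from (⟦⟧-cong β e _)))
  where open Equivalence
⟦⟧-cong (α R β)  e k =
  mk⇔ (Release-map (to (⟦⟧-cong α e _)) (to (⟦⟧-cong β e _)))
      (Release-map (from (⟦⟧-cong α e _)) (from (⟦⟧-cong β e _)))
  where open Equivalence

-- From arenas to the semantics of ATL

HalfPositionalModality : Modality → Set₁
HalfPositionalModality (n , α) =
  ∀ (𝒢 : Arena) (V : Fin n → Pred (Arena.State 𝒢) 0ℓ) →
  Arena.HalfPositional 𝒢 (λ π → ⟦ α ⟧ (λ i → V i ∘ π) 0)

-- The environment completes a joint action of `C`, so `Outcome` unfolds to `Consistent` up to the
-- order of the arguments of the strategy.
coalitionArena : ∀ {k AP} → CGS k AP → Subset k → Arena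
coalitionArena M C = record
  { size    = size
  ; Move    = λ x → ∀ i → i ∈ C → Act i x
  ; Succ    = λ x m y → Σ (∀ i → Act i x) λ a → (∀ i i∈C → a i ≡ m i i∈C) × δ x a ≡ y
  ; default = λ x i _ → inhabited i x
  ; total   = λ x m → δ x (complete m) , complete m , complete-extends m , refl
  }
  where
  open CGS M
  complete : ∀ {x} → (∀ i → i ∈ C → Act i x) → ∀ i → Act i x
  complete {x} m i with i ∈? C
  ... | yes i∈C = m i i∈C
  ... | no _    = inhabited i x

  complete-extends : ∀ {x} (m : ∀ i → i ∈ C → Act i x) i i∈C → complete m i ≡ m i i∈C
  complete-extends m i i∈C with i ∈? C
  -- `m` takes the membership proof as an argument, so the two proofs must be identified.
  ... | yes i∈C′ = cong (m i) ([]=-irrelevant i∈C′ i∈C)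
  ... | no i∉C   = ⊥-elim (i∉C i∈C)

module _ (em : ExcludedMiddle 0ℓ) {𝒜 : Pred Modality 0ℓ}
         (hp : ∀ {α} → 𝒜 α → HalfPositionalModality α)
         {k : ℕ} {AP : Set} (M : CGS k AP) where

  path-halfPositional : ∀ C (φ : PathFormula k AP 𝒜) →
    Arena.HalfPositional (coalitionArena M C) (λ π → _⊩[_]_ M π regular φ)
  path-halfPositional C (Xᵖ ψ)   =
    next-halfPositional em (coalitionArena M C) (λ x → _⊨[_]_ M x regular ψ)
  path-halfPositional C (ψ Uᵖ χ) = until-halfPositional em (coalitionArena M C)
    (λ x → _⊨[_]_ M x regular ψ) (λ x → _⊨[_]_ M x regular χ)
  path-halfPositional C (ψ Rᵖ χ) = release-halfPositional em (coalitionArena M C)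
    (λ x → _⊨[_]_ M x regular ψ) (λ x → _⊨[_]_ M x regular χ)
  path-halfPositional C ((_ , α∈𝒜) [ ψs ]) =
    hp α∈𝒜 (coalitionArena M C) (λ i x → _⊨[_]_ M x regular (ψs i))

  mutual
    state-agree : ∀ ψ x → _⊨[_]_ M x regular ψ ⇔ _⊨[_]_ M x positional ψ
    state-agree (atom p)  x = mk⇔ id id
    state-agree (ψ ∨ˢ χ)  x = state-agree ψ x ⊎-⇔ state-agree χ x
    state-agree (¬ˢ ψ)    x = let open Equivalence (state-agree ψ x) in mk⇔ (_∘ from) (_∘ to)
    state-agree (⟨ C ⟩ φ) x = mk⇔
      -- Memory is removed first, for the objective in the regular semantics; only then does
      -- `path-agree` change the reading of the subformulas.
      (λ (σ , _ , win) →
        let (f , f-win) = path-halfPositional C φ x ((λ h x i i∈C → σ i i∈C h x) , win)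
        in (λ i i∈C _ x → f x i i∈C) , (λ _ _ _ _ _ → refl) ,
           λ π e c → Equivalence.to (path-agree φ π) (f-win π e c))
      (λ (σ , _ , win) → σ , tt , λ π e c → Equivalence.from (path-agree φ π) (win π e c))

    path-agree : ∀ φ π → _⊩[_]_ M π regular φ ⇔ _⊩[_]_ M π positional φ
    path-agree (Xᵖ ψ)   π = state-agree ψ (π 1)
    path-agree (ψ Uᵖ χ) π =
      mk⇔ (Until-map (to (state-agree ψ _)) (to (state-agree χ _)))
          (Until-map (from (state-agree ψ _)) (from (state-agree χ _)))
      where open Equivalence
    path-agree (ψ Rᵖ χ) π =
      mk⇔ (Release-map (to (state-agree ψ _)) (to (state-agree χ _)))
          (Release-map (from (state-agree ψ _)) (from (state-agree χ _)))
      where open Equivalence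
    path-agree (((_ , α) , _) [ ψs ]) π =
      ⟦⟧-cong α (λ i n → state-agree (ψs i) (π n)) 0

-- The four modalities

module _ (em : ExcludedMiddle 0ℓ) where

  semanticsIsPositional : ∀ {α} → HalfPositionalModality α → SemanticsIsPositional ｛ α ｝
  semanticsIsPositional hp k AP M = state-agree em (λ { refl → hp }) M

  open Equivalence

  GF∧FG : HalfPositionalModality (2 , (G (F var 0F)) ∧′ (F (G var 1F)))
  GF∧FG 𝒢 V = Arena.HalfPositional-resp 𝒢
    (λ (_ , p , q) → from infinitely-often p , from eventually-always q)
    (λ (p , q) → _ , to infinitely-often p , to eventually-always q)
    (rabin-halfPositional em 𝒢 (λ _ → Unary.U) (V 0F) (V 1F))

  -- The third conjunct becomes the edge condition, read at the source.
  GF∧FG∧G : HalfPositionalModality (3 , (G (F var 0F)) ∧′ (F (G var 1F)) ∧′ (G var 2F))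
  GF∧FG∧G 𝒢 V = Arena.HalfPositional-resp 𝒢
    (λ (r , p , q) → from infinitely-often p ,
                     from eventually-always q , from globally r)
    (λ (p , q , r) → to globally r , to infinitely-often p ,
                     to eventually-always q)
    (rabin-halfPositional em 𝒢 (λ x _ → V 2F x) (V 0F) (V 1F))

  -- An edge condition on both endpoints expresses `ψ ∨ X ψ`; this is why `E` is a relation and not
  -- a set of states.
  G[∨X] : HalfPositionalModality (1 , G (var 0F ∨′ X var 0F))
  G[∨X] 𝒢 V = Arena.HalfPositional-resp 𝒢
    (λ (r , _) → from globally r)
    (λ g → to globally g , (λ n → n , ≤-refl , tt) , 0 , _)
    (rabin-halfPositional em 𝒢 (λ x y → V 0F x ⊎ V 0F y) Unary.U Unary.U)

  -- `G (P U Q)` amounts to `P ∨ Q` at all times together with `GF Q`.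
  G[U] : HalfPositionalModality (2 , G (var 0F U var 1F))
  G[U] 𝒢 V = Arena.HalfPositional-resp 𝒢
    (λ (r , q , _) → from globally λ n → until r n (q n))
    (λ g → let u = to globally g in
      (λ n → first (u n)) , (λ n → let (m , n≤m , q , _) = u n in m , n≤m , q) , 0 , _)
    (rabin-halfPositional em 𝒢 (λ x _ → V 0F x ⊎ V 1F x) (V 1F) Unary.U)
    where
    first : ∀ {P Q : Pred ℕ 0ℓ} {n} → Until P Q n → P n ⊎ Q n
    first {n = n} (m , n≤m , q , p) with m≤n⇒m<n∨m≡n n≤m
    ... | inj₁ n<m  = inj₁ (p n ≤-refl n<m)
    ... | inj₂ refl = inj₂ q

    -- Before the first `Q` at or after `n`, the disjunction leaves only `P`.
    until : ∀ {P Q : Pred ℕ 0ℓ} → (∀ n → P n ⊎ Q n) →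
            ∀ n → (∃ λ m → n ≤ m × Q m) → Until P Q n
    until {P} {Q} pq n (m , n≤m×q) with least em {λ m → n ≤ m × Q m} m n≤m×q
    ... | m , (n≤m , q) , min = m , n≤m , q , λ i n≤i i<m →
      Sum.[ id , (λ q → ⊥-elim (<⇒≱ i<m (min i (n≤i , q)))) ] (pq i)

proposition33 : ExcludedMiddle 0ℓ →
    All (λ (α : Modality) → SemanticsIsPositional ｛ α ｝)
    ( (2 , (G (F var 0F)) ∧′ (F (G var 1F)))
    ∷ (2 , G (var 0F U var 1F))
    ∷ (3 , (G (F var 0F)) ∧′ (F (G var 1F)) ∧′ (G var 2F))
    ∷ (1 , G (var 0F ∨′ X var 0F))
    ∷ [] )
proposition33 em =
    semanticsIsPositional em (GF∧FG em)
  ∷ semanticsIsPositional em (G[U] em)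
  ∷ semanticsIsPositional em (GF∧FG∧G em)
  ∷ semanticsIsPositional em (G[∨X] em)
  ∷ []
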